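{- Let $k\geq 3$ and $\mathbf{x}=(x_1,\ldots,x_n)\in\Delta^{n-1}$, and let $q=q(\mathbf{x})$. If $|\mathbf{x}|_{\max}<1/(k-1)$, then \[ S_k(\mathbf{x})>q^k\binom{1/q}{k}, \] unless the nonzero entries of $\mathbf{x}$ are equal.
   Context: $\Delta^{n-1}=\{\mathbf{x}\in\mathbb{R}^n: x_i\geq0 \text{ for all } i,\ \sum_i x_i=1\}$. $S_k(\mathbf{x})$ denotes the $k$-th elementary symmetric polynomial of $x_1,\ldots,x_n$. $q(\mathbf{x})=x_1^2+\cdots+x_n^2$. $|\mathbf{x}|_{\max}=\max_i x_i$. For real $s$, $\binom{s}{k}=s(s-1)\cdots(s-k+1)/k!$. -}

module Defs where

open import Algebra.Bundles using (CommutativeRing; Semiring)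
import Algebra.Construct.NaturalChoice.Max as Max
import Algebra.Definitions.RawSemiring as RawSemiringDefs
open import Data.Bool.Base using (if_then_else_)
open import Data.Fin.Base using (Fin; toℕ)
open import Data.Fin.Subset using (Subset; inside; outside; ∣_∣)
open import Data.List.Base as List using (List; []; _∷_; _++_)
open import Data.Nat.Base as ℕ using (ℕ; zero; suc; _!)
import Data.Nat.Properties as ℕ
open import Data.Product.Base using (∃; _×_)
open import Data.Vec.Base as Vec using ([]; _∷_)
open import Data.Vec.Functional using (Vector; head; tail; foldr)
open import Level using (Level; _⊔_) renaming (suc to lsuc)
open import Relation.Binary.Bundles using (DecTotalOrder)
import Relation.Binary.Construct.NonStrictToStrict as ToStrict
open import Relation.Binary.Core using (Rel)
open import Relation.Binary.Structures using (IsDecTotalOrder)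
open import Relation.Nullary.Negation using (¬_)
open import Relation.Unary using (Pred)

-- Dedekind-complete ordered fields.  Classically ℝ is the only one up to
-- isomorphism, so a statement about every such structure is a statement
-- about ℝ.  The order is decidable, as it is for the classical reals.
record CompleteOrderedField c ℓ₁ ℓ₂ : Set (lsuc (c ⊔ ℓ₁ ⊔ ℓ₂)) where
  infix 4 _≤_
  infix 9 _⁻¹
  field
    commutativeRing : CommutativeRing c ℓ₁

  open CommutativeRing commutativeRing public

  field
    _≤_             : Rel Carrier ℓ₂
    isDecTotalOrder : IsDecTotalOrder _≈_ _≤_
    +-monoʳ-≤       : ∀ z {x y} → x ≤ y → z + x ≤ z + y
    *-nonNegative   : ∀ {x y} → 0# ≤ x → 0# ≤ y → 0# ≤ x * y

    -- The value of 0# ⁻¹ is unspecified.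
    _⁻¹             : Carrier → Carrier
    ⁻¹-inverseʳ     : ∀ {x} → x ≉ 0# → x * x ⁻¹ ≈ 1#
    0≉1             : 0# ≉ 1#

  UpperBound : ∀ {p} → Pred Carrier p → Carrier → Set (c ⊔ ℓ₂ ⊔ p)
  UpperBound P u = ∀ x → P x → x ≤ u

  field
    supremum : (P : Pred Carrier (c ⊔ ℓ₁ ⊔ ℓ₂)) → ∃ P → ∃ (UpperBound P) →
               ∃ λ s → UpperBound P s × (∀ u → UpperBound P u → s ≤ u)

  decTotalOrder : DecTotalOrder c ℓ₁ ℓ₂
  decTotalOrder = record { isDecTotalOrder = isDecTotalOrder }

  open DecTotalOrder decTotalOrder public using (totalOrder)
  open ToStrict _≈_ _≤_ public using (_<_)

allSubsets : ∀ n → List (Subset n)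
allSubsets zero    = [] ∷ []
allSubsets (suc n) = List.map (inside ∷_) (allSubsets n) ++
                     List.map (outside ∷_) (allSubsets n)

subsetsOfSize : ℕ → ∀ n → List (Subset n)
subsetsOfSize k n = List.filter (λ p → ∣ p ∣ ℕ.≟ k) (allSubsets n)

module Notions {c ℓ₁ ℓ₂} (ℝ : CompleteOrderedField c ℓ₁ ℓ₂) where
  open CompleteOrderedField ℝ
  open Max totalOrder using () renaming (_⊔_ to max)
  open RawSemiringDefs (Semiring.rawSemiring semiring) public using (sum; product; _^_)
  open RawSemiringDefs (Semiring.rawSemiring semiring) using () renaming (_×_ to _×ᴺ_)

  infixl 7 _/_

  _/_ : Carrier → Carrier → Carrier
  x / y = x * y ⁻¹

  fromℕ : ℕ → Carrier
  fromℕ n = n ×ᴺ 1#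

  -- Δ m is the m-dimensional simplex, in m + 1 coordinates.
  Δ : ∀ m → Pred (Vector Carrier (suc m)) (ℓ₁ ⊔ ℓ₂)
  Δ m x = (∀ i → 0# ≤ x i) × sum x ≈ 1#

  monomial : ∀ {n} → Vector Carrier n → Subset n → Carrier
  monomial x p = product λ i → if Vec.lookup p i then x i else 1#

  S : ∀ {n} → ℕ → Vector Carrier n → Carrier
  S {n} k x = List.foldr _+_ 0# (List.map (monomial x) (subsetsOfSize k n))

  q : ∀ {n} → Vector Carrier n → Carrier
  q x = sum λ i → x i ^ 2

  ∣_∣max : ∀ {m} → Vector Carrier (suc m) → Carrier
  ∣ x ∣max = foldr max (head x) (tail x)

  binom : Carrier → ℕ → Carrier
  binom s k = product (λ (i : Fin k) → s - fromℕ (toℕ i)) / fromℕ (k !)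

  NonzeroEntriesEqual : ∀ {n} → Vector Carrier n → Set ℓ₁
  NonzeroEntriesEqual x = ∀ i j → x i ≉ 0# → x j ≉ 0# → x i ≈ x j

{-# OPTIONS --safe #-}

-- Let e_k be the elementary symmetric functions and d_k,i the k-th one of the
-- entries other than x_i.  Since e_{k+1} = x_i d_k,i + d_{k+1},i and
-- Σ_i x_i d_k,i = (k + 1) e_{k+1}, weighting by x_i and summing gives
--   e_{k+1} = Σ_i x_i² d_k,i + (k + 2) e_{k+2}   when Σ_i x_i = 1.
-- As d_k,i decreases with x_i, Chebyshev's sum inequality (with weights x_i)
-- yields Σ_i x_i² d_k,i ≤ q Σ_i x_i d_k,i = q (k + 1) e_{k+1}, whence
--   (k + 2)! e_{k+2} ≥ (k + 1)! e_{k+1} (1 - (k + 1) q).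
-- For k = 1 the inequality is strict: it amounts to q² < Σ_i x_i³, and
-- Σ_i x_i³ - q² = Σ_i x_i (x_i - q)².  Iterating is possible because
-- q ≤ max_i x_i, so that all the factors 1 - j q that occur are positive.
module Submission where

open import Defs
import Algebra.Construct.NaturalChoice.Max as Max
import Algebra.Properties.Group as GroupProperties
import Algebra.Properties.Ring as RingProperties
import Algebra.Properties.Semiring.Mult as SemiringMult
import Algebra.Properties.Semiring.Sum as SemiringSum
import Algebra.Solver.Ring.NaturalCoefficients.Default as NaturalSolver
open import Data.Fin.Base using (Fin; zero; suc; toℕ)
open import Data.Fin.Subset using (Subset; inside; outside; ∣_∣)
open import Data.Bool.Base using (true; false)
open import Data.List.Base as List using (List; []; _∷_; _++_)
open import Data.List.Properties using (filter-++)
open import Data.Nat.Base as ℕ using (ℕ; zero; suc; _!)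
import Data.Nat.Properties as ℕ
open import Data.Product.Base using (∃; _×_; _,_; proj₁; proj₂)
open import Data.Sum.Base using (inj₁; inj₂)
import Data.Vec.Base as Vec
open import Data.Vec.Functional using (Vector; head; tail; foldr; replicate)
open import Relation.Binary.Bundles using (DecTotalOrder)
import Relation.Binary.Properties.DecTotalOrder as DecTotalOrderProperties
import Relation.Binary.PropositionalEquality.Core as ≡
import Relation.Binary.Reasoning.PartialOrder as PartialOrderReasoning
open import Relation.Nullary.Decidable using (does; yes; no)
open import Relation.Nullary.Negation using (¬_; contradiction)

-- Order and arithmetic in an ordered field.

module OrderedFieldProperties {c ℓ₁ ℓ₂} (ℝ : CompleteOrderedField c ℓ₁ ℓ₂) where
  open CompleteOrderedField ℝ
  open DecTotalOrder decTotalOrder public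
    using (poset; antisym; total; _≟_)
    renaming (refl to ≤-refl; reflexive to ≤-reflexive; trans to ≤-trans)
  open DecTotalOrderProperties decTotalOrder public
    using (<⇒≱; ≰⇒>)
  open GroupProperties +-group using (⁻¹-involutive; //-rightDividesˡ)
    renaming (∙-cancelˡ to +-cancelˡ)
  open RingProperties ring using (-1*x≈-x)
  open NaturalSolver commutativeSemiring using (solve; _:=_; _:+_; _:*_)
  open PartialOrderReasoning poset

  +-mono-≤ : ∀ {x y u v} → x ≤ y → u ≤ v → x + u ≤ y + v
  +-mono-≤ {x} {y} {u} {v} x≤y u≤v = begin
    x + u  ≤⟨ +-monoʳ-≤ x u≤v ⟩
    x + v  ≈⟨ +-comm x v ⟩
    v + x  ≤⟨ +-monoʳ-≤ v x≤y ⟩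
    v + y  ≈⟨ +-comm v y ⟩
    y + v  ∎

  +-monoʳ-< : ∀ z {x y} → x < y → z + x < z + y
  +-monoʳ-< z (x≤y , x≉y) = +-monoʳ-≤ z x≤y , λ eq → x≉y (+-cancelˡ z _ _ eq)

  +-nonNegative : ∀ {x y} → 0# ≤ x → 0# ≤ y → 0# ≤ x + y
  +-nonNegative 0≤x 0≤y = ≤-trans (≤-reflexive (sym (+-identityˡ 0#))) (+-mono-≤ 0≤x 0≤y)

  x≤x+y : ∀ x {y} → 0# ≤ y → x ≤ x + y
  x≤x+y x 0≤y = ≤-trans (≤-reflexive (sym (+-identityʳ x))) (+-monoʳ-≤ x 0≤y)

  +-cancelˡ-≤ : ∀ z {x y} → z + x ≤ z + y → x ≤ y
  +-cancelˡ-≤ z {x} {y} zx≤zy = begin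
    x              ≈⟨ cancel x ⟨
    - z + (z + x)  ≤⟨ +-monoʳ-≤ (- z) zx≤zy ⟩
    - z + (z + y)  ≈⟨ cancel y ⟩
    y              ∎
    where
    cancel : ∀ w → - z + (z + w) ≈ w
    cancel w = trans (sym (+-assoc _ _ _)) (trans (+-congʳ (-‿inverseˡ z)) (+-identityˡ w))

  +-cancelˡ-< : ∀ z {x y} → z + x < z + y → x < y
  +-cancelˡ-< z (zx≤zy , zx≉zy) = +-cancelˡ-≤ z zx≤zy , λ eq → zx≉zy (+-congˡ eq)

  x+[y-x]≈y : ∀ x y → x + (y - x) ≈ y
  x+[y-x]≈y x y = trans (+-comm x (y - x)) (//-rightDividesˡ x y)

  -- Trading an inequality for an equation with a nonnegative summand reduces the monotonicity facts
  -- below to identities of commutative semirings.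
  ≤⇒≈+ : ∀ {x y} → x ≤ y → ∃ λ u → 0# ≤ u × y ≈ x + u
  ≤⇒≈+ {x} {y} x≤y = y - x , +-cancelˡ-≤ x x+0≤x+u , sym (x+[y-x]≈y x y)
    where
    x+0≤x+u : x + 0# ≤ x + (y - x)
    x+0≤x+u = begin
      x + 0#       ≈⟨ +-identityʳ x ⟩
      x            ≤⟨ x≤y ⟩
      y            ≈⟨ x+[y-x]≈y x y ⟨
      x + (y - x)  ∎

  *-monoʳ-≤ : ∀ {z x y} → 0# ≤ z → x ≤ y → z * x ≤ z * y
  *-monoʳ-≤ {z} {x} {y} 0≤z x≤y with u , 0≤u , y≈x+u ← ≤⇒≈+ x≤y = begin
    z * x          ≤⟨ x≤x+y (z * x) (*-nonNegative 0≤z 0≤u) ⟩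
    z * x + z * u  ≈⟨ distribˡ z x u ⟨
    z * (x + u)    ≈⟨ *-congˡ y≈x+u ⟨
    z * y          ∎

  *-monoˡ-≤ : ∀ {z x y} → 0# ≤ z → x ≤ y → x * z ≤ y * z
  *-monoˡ-≤ {z} {x} {y} 0≤z x≤y = begin
    x * z  ≈⟨ *-comm x z ⟩
    z * x  ≤⟨ *-monoʳ-≤ 0≤z x≤y ⟩
    z * y  ≈⟨ *-comm z y ⟩
    y * z  ∎

  *-cancelˡ : ∀ z {x y} → z ≉ 0# → z * x ≈ z * y → x ≈ y
  *-cancelˡ z {x} {y} z≉0 eq = trans (sym (cancel x)) (trans (*-congˡ eq) (cancel y))
    where
    cancel : ∀ w → z ⁻¹ * (z * w) ≈ w
    cancel w = begin-equality
      z ⁻¹ * (z * w)  ≈⟨ solve 3 (λ a b c → a :* (b :* c) := (b :* a) :* c) refl (z ⁻¹) z w ⟩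
      (z * z ⁻¹) * w  ≈⟨ *-congʳ (⁻¹-inverseʳ z≉0) ⟩
      1# * w          ≈⟨ *-identityˡ w ⟩
      w               ∎

  >⇒≉ : ∀ {x y} → x < y → y ≉ x
  >⇒≉ (_ , x≉y) y≈x = x≉y (sym y≈x)

  *-monoʳ-< : ∀ {z x y} → 0# < z → x < y → z * x < z * y
  *-monoʳ-< {z} 0<z (x≤y , x≉y) =
    *-monoʳ-≤ (proj₁ 0<z) x≤y , λ eq → x≉y (*-cancelˡ z (>⇒≉ 0<z) eq)

  *-monoˡ-< : ∀ {z x y} → 0# < z → x < y → x * z < y * z
  *-monoˡ-< {z} {x} {y} 0<z x<y = begin-strict
    x * z  ≈⟨ *-comm x z ⟩
    z * x  <⟨ *-monoʳ-< 0<z x<y ⟩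
    z * y  ≈⟨ *-comm z y ⟩
    y * z  ∎

  *-positive : ∀ {x y} → 0# < x → 0# < y → 0# < x * y
  *-positive {x} {y} 0<x 0<y = begin-strict
    0#      ≈⟨ zeroʳ x ⟨
    x * 0#  <⟨ *-monoʳ-< 0<x 0<y ⟩
    x * y   ∎

  x≤0⇒0≤-x : ∀ {x} → x ≤ 0# → 0# ≤ - x
  x≤0⇒0≤-x {x} x≤0 = +-cancelˡ-≤ x (begin
    x + 0#   ≈⟨ +-identityʳ x ⟩
    x        ≤⟨ x≤0 ⟩
    0#       ≈⟨ -‿inverseʳ x ⟨
    x + - x  ∎)

  -x*-x≈x*x : ∀ x → - x * - x ≈ x * x
  -x*-x≈x*x x = begin-equality
    - x * - x              ≈⟨ *-cong (-1*x≈-x x) (-1*x≈-x x) ⟨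
    (- 1# * x) * (- 1# * x) ≈⟨ solve 2 (λ a b → (a :* b) :* (a :* b) := (a :* a) :* (b :* b)) refl (- 1#) x ⟩
    (- 1# * - 1#) * (x * x) ≈⟨ *-congʳ (trans (-1*x≈-x (- 1#)) (⁻¹-involutive 1#)) ⟩
    1# * (x * x)           ≈⟨ *-identityˡ _ ⟩
    x * x                  ∎

  0≤x*x : ∀ x → 0# ≤ x * x
  0≤x*x x with total 0# x
  ... | inj₁ 0≤x = *-nonNegative 0≤x 0≤x
  ... | inj₂ x≤0 = ≤-trans (*-nonNegative 0≤-x 0≤-x) (≤-reflexive (-x*-x≈x*x x))
    where 0≤-x = x≤0⇒0≤-x x≤0

  0<1 : 0# < 1#
  0<1 = ≤-trans (0≤x*x 1#) (≤-reflexive (*-identityˡ 1#)) , 0≉1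

  x≉0⇒x*x≉0 : ∀ {x} → x ≉ 0# → x * x ≉ 0#
  x≉0⇒x*x≉0 {x} x≉0 xx≈0 = x≉0 (*-cancelˡ x x≉0 (trans xx≈0 (sym (zeroʳ x))))

  x≉0⇒0<x*x : ∀ {x} → x ≉ 0# → 0# < x * x
  x≉0⇒0<x*x {x} x≉0 = 0≤x*x x , λ eq → x≉0⇒x*x≉0 x≉0 (sym eq)

  ⁻¹-positive : ∀ {x} → 0# < x → 0# < x ⁻¹
  ⁻¹-positive {x} 0<x = ≰⇒> λ x⁻¹≤0 → <⇒≱ 0<1 (begin
    1#        ≈⟨ ⁻¹-inverseʳ (>⇒≉ 0<x) ⟨
    x * x ⁻¹  ≤⟨ *-monoʳ-≤ (proj₁ 0<x) x⁻¹≤0 ⟩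
    x * 0#    ≈⟨ zeroʳ x ⟩
    0#        ∎)

  x<y⇒0<y-x : ∀ {x y} → x < y → 0# < y - x
  x<y⇒0<y-x {x} {y} x<y = +-cancelˡ-< x (begin-strict
    x + 0#       ≈⟨ +-identityʳ x ⟩
    x            <⟨ x<y ⟩
    y            ≈⟨ x+[y-x]≈y x y ⟨
    x + (y - x)  ∎)

  -- With `y = x + u` and `a = b + v`, the two sides differ by `u * v`, which is nonnegative.
  rearrangement : ∀ {x y a b} → x ≤ y → b ≤ a → x * a + y * b ≤ x * b + y * a
  rearrangement {x} {y} {a} {b} x≤y b≤a
    with u , 0≤u , y≈x+u ← ≤⇒≈+ x≤y | v , 0≤v , a≈b+v ← ≤⇒≈+ b≤a = begin
    x * a + y * b                        ≈⟨ +-cong (*-congˡ a≈b+v) (*-congʳ y≈x+u) ⟩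
    x * (b + v) + (x + u) * b            ≤⟨ x≤x+y _ (*-nonNegative 0≤u 0≤v) ⟩
    x * (b + v) + (x + u) * b + u * v    ≈⟨ solve 4 (λ x u b v → x :* (b :+ v) :+ (x :+ u) :* b :+ u :* v
                                                := x :* b :+ (x :+ u) :* (b :+ v)) refl x u b v ⟩
    x * b + (x + u) * (b + v)            ≈⟨ +-congˡ (*-cong y≈x+u a≈b+v) ⟨
    x * b + y * a                        ∎

-- Finite sums, Chebyshev's sum inequality, finite products.

module SumProperties {c ℓ₁ ℓ₂} (ℝ : CompleteOrderedField c ℓ₁ ℓ₂) where
  open CompleteOrderedField ℝ hiding (zero)
  open Notions ℝ
  open OrderedFieldProperties ℝ
  open Max totalOrder using (x≤x⊔y; x≤y⊔x) renaming (_⊔_ to max)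
  open SemiringSum semiring public using (sum-cong-≋; sum-replicate-zero; ∑-distrib-+; *-distribˡ-sum)
  open NaturalSolver commutativeSemiring using (solve; _:=_; _:+_; _:*_)
  open PartialOrderReasoning poset

  sum-mono-≤ : ∀ {n} {f g : Vector Carrier n} → (∀ i → f i ≤ g i) → sum f ≤ sum g
  sum-mono-≤ {zero}  f≤g = ≤-refl
  sum-mono-≤ {suc n} f≤g = +-mono-≤ (f≤g zero) (sum-mono-≤ λ i → f≤g (suc i))

  sum-nonNegative : ∀ {n} {f : Vector Carrier n} → (∀ i → 0# ≤ f i) → 0# ≤ sum f
  sum-nonNegative {zero}  0≤f = ≤-refl
  sum-nonNegative {suc n} 0≤f = +-nonNegative (0≤f zero) (sum-nonNegative λ i → 0≤f (suc i))

  term≤sum : ∀ {n} {f : Vector Carrier n} → (∀ i → 0# ≤ f i) → ∀ i → f i ≤ sum f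
  term≤sum {f = f} 0≤f zero = x≤x+y (f zero) (sum-nonNegative λ i → 0≤f (suc i))
  term≤sum {f = f} 0≤f (suc i) = begin
    f (suc i)              ≤⟨ term≤sum (λ j → 0≤f (suc j)) i ⟩
    sum (tail f)           ≤⟨ x≤x+y (sum (tail f)) (0≤f zero) ⟩
    sum (tail f) + f zero  ≈⟨ +-comm (sum (tail f)) (f zero) ⟩
    sum f                  ∎

  sum-nonPositive⇒≈0 : ∀ {n} {f : Vector Carrier n} → (∀ i → 0# ≤ f i) →
                       sum f ≤ 0# → ∀ i → f i ≈ 0#
  sum-nonPositive⇒≈0 0≤f ∑f≤0 i = antisym (≤-trans (term≤sum 0≤f i) ∑f≤0) (0≤f i)

  x≤∣x∣max : ∀ {m} (x : Vector Carrier (suc m)) i → x i ≤ ∣ x ∣max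
  -- The maximum is a fold over the tail with the head as its initial value, so head and tail
  -- entries need separate inductions.
  x≤∣x∣max x zero    = head≤ (tail x)
    where
    head≤ : ∀ {n a} (t : Vector Carrier n) → a ≤ foldr max a t
    head≤ {zero}  t = ≤-refl
    head≤ {suc n} t = ≤-trans (head≤ (tail t)) (x≤y⊔x (head t) _)
  x≤∣x∣max x (suc i) = tail≤ (tail x) i
    where
    tail≤ : ∀ {n a} (t : Vector Carrier n) i → t i ≤ foldr max a t
    tail≤ t zero    = x≤x⊔y (t zero) _
    tail≤ t (suc i) = ≤-trans (tail≤ (tail t) i) (x≤y⊔x (head t) _)

  -- The two-term inequalities between the pair `x₀`, `d₀` and each further pair, weighted by `a i`
  -- and summed. These are the mixed terms in the inductive step of `chebyshev`.
  chebyshev-cross : ∀ {n} (a x d : Vector Carrier n) (x₀ d₀ : Carrier) → (∀ i → 0# ≤ a i) →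
                    (∀ i → x₀ * d₀ + x i * d i ≤ x₀ * d i + x i * d₀) →
                    x₀ * d₀ * sum a + sum (λ i → a i * (x i * d i)) ≤
                    x₀ * sum (λ i → a i * d i) + sum (λ i → a i * x i) * d₀
  chebyshev-cross {n} a x d x₀ d₀ 0≤a cross = begin
    x₀ * d₀ * sum a + sum (λ i → a i * (x i * d i))
      ≈⟨ +-congʳ (*-distribˡ-sum (x₀ * d₀) a) ⟩
    sum (λ i → x₀ * d₀ * a i) + sum (λ i → a i * (x i * d i))
      ≈⟨ ∑-distrib-+ (λ i → x₀ * d₀ * a i) (λ i → a i * (x i * d i)) ⟨
    sum (λ i → x₀ * d₀ * a i + a i * (x i * d i))
      ≤⟨ sum-mono-≤ termwise ⟩
    sum (λ i → x₀ * (a i * d i) + d₀ * (a i * x i))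
      ≈⟨ ∑-distrib-+ (λ i → x₀ * (a i * d i)) (λ i → d₀ * (a i * x i)) ⟩
    sum (λ i → x₀ * (a i * d i)) + sum (λ i → d₀ * (a i * x i))
      ≈⟨ +-cong (*-distribˡ-sum x₀ (λ i → a i * d i)) (*-distribˡ-sum d₀ (λ i → a i * x i)) ⟨
    x₀ * sum (λ i → a i * d i) + d₀ * sum (λ i → a i * x i)
      ≈⟨ +-congˡ (*-comm d₀ _) ⟩
    x₀ * sum (λ i → a i * d i) + sum (λ i → a i * x i) * d₀ ∎
    where
    termwise : ∀ i → x₀ * d₀ * a i + a i * (x i * d i) ≤ x₀ * (a i * d i) + d₀ * (a i * x i)
    termwise i = begin
      x₀ * d₀ * a i + a i * (x i * d i)
        ≈⟨ solve 5 (λ x₀ d₀ a x d → x₀ :* d₀ :* a :+ a :* (x :* d) := a :* (x₀ :* d₀ :+ x :* d))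
             refl x₀ d₀ (a i) (x i) (d i) ⟩
      a i * (x₀ * d₀ + x i * d i)
        ≤⟨ *-monoʳ-≤ (0≤a i) (cross i) ⟩
      a i * (x₀ * d i + x i * d₀)
        ≈⟨ solve 5 (λ x₀ d₀ a x d → a :* (x₀ :* d :+ x :* d₀) := x₀ :* (a :* d) :+ d₀ :* (a :* x))
             refl x₀ d₀ (a i) (x i) (d i) ⟩
      x₀ * (a i * d i) + d₀ * (a i * x i) ∎

  -- Induction on the length: once both products are expanded, the terms from the head alone agree,
  -- the mixed terms are compared by `chebyshev-cross`, and the terms from the tails alone by the
  -- induction hypothesis.
  chebyshev : ∀ {n} (a x d : Vector Carrier n) → (∀ i → 0# ≤ a i) →
              (∀ i j → x i ≤ x j → d j ≤ d i) →
              sum a * sum (λ i → a i * (x i * d i)) ≤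
              sum (λ i → a i * x i) * sum (λ i → a i * d i)
  chebyshev {zero}  a x d 0≤a antitone = ≤-refl
  chebyshev {suc n} a x d 0≤a antitone = begin
    (a₀ + A) * (a₀ * (x₀ * d₀) + P)
      ≈⟨ solve 5 (λ a₀ x₀ d₀ A P → (a₀ :+ A) :* (a₀ :* (x₀ :* d₀) :+ P)
                    := a₀ :* x₀ :* (a₀ :* d₀) :+ (a₀ :* (x₀ :* d₀ :* A :+ P) :+ A :* P))
           refl a₀ x₀ d₀ A P ⟩
    a₀ * x₀ * (a₀ * d₀) + (a₀ * (x₀ * d₀ * A + P) + A * P)
      ≤⟨ +-monoʳ-≤ _ (+-mono-≤
           (*-monoʳ-≤ (0≤a zero) (chebyshev-cross (tail a) (tail x) (tail d) x₀ d₀ (λ i → 0≤a (suc i)) cross))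
           (chebyshev (tail a) (tail x) (tail d) (λ i → 0≤a (suc i)) λ i j → antitone (suc i) (suc j))) ⟩
    a₀ * x₀ * (a₀ * d₀) + (a₀ * (x₀ * D + X * d₀) + X * D)
      ≈⟨ solve 5 (λ a₀ x₀ d₀ X D → a₀ :* x₀ :* (a₀ :* d₀) :+ (a₀ :* (x₀ :* D :+ X :* d₀) :+ X :* D)
                    := (a₀ :* x₀ :+ X) :* (a₀ :* d₀ :+ D))
           refl a₀ x₀ d₀ X D ⟩
    (a₀ * x₀ + X) * (a₀ * d₀ + D) ∎
    where
    a₀ = head a
    x₀ = head x
    d₀ = head d
    A = sum (tail a)
    P = sum λ i → tail a i * (tail x i * tail d i)
    X = sum λ i → tail a i * tail x i
    D = sum λ i → tail a i * tail d i

    cross : ∀ i → x₀ * d₀ + tail x i * tail d i ≤ x₀ * tail d i + tail x i * d₀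
    -- Whichever of `x₀` and `xᵢ` is larger, the `d` values are in the opposite order, so
    -- `rearrangement` applies after exchanging roles if necessary.
    cross i with total x₀ (tail x i)
    ... | inj₁ x₀≤xᵢ = rearrangement x₀≤xᵢ (antitone zero (suc i) x₀≤xᵢ)
    ... | inj₂ xᵢ≤x₀ = begin
      x₀ * d₀ + tail x i * tail d i  ≈⟨ +-comm _ _ ⟩
      tail x i * tail d i + x₀ * d₀  ≤⟨ rearrangement xᵢ≤x₀ (antitone (suc i) zero xᵢ≤x₀) ⟩
      tail x i * d₀ + x₀ * tail d i  ≈⟨ +-comm _ _ ⟩
      x₀ * tail d i + tail x i * d₀  ∎

  fromℕ-nonNegative : ∀ n → 0# ≤ fromℕ n
  fromℕ-nonNegative zero    = ≤-refl
  fromℕ-nonNegative (suc n) = +-nonNegative (proj₁ 0<1) (fromℕ-nonNegative n)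

  fromℕ-positive : ∀ n .{{_ : ℕ.NonZero n}} → 0# < fromℕ n
  fromℕ-positive (suc n) = begin-strict
    0#            <⟨ 0<1 ⟩
    1#            ≤⟨ x≤x+y 1# (fromℕ-nonNegative n) ⟩
    1# + fromℕ n  ∎

  fromℕ-mono-≤ : ∀ {m n} → m ℕ.≤ n → fromℕ m ≤ fromℕ n
  fromℕ-mono-≤ {n = n} ℕ.z≤n = fromℕ-nonNegative n
  fromℕ-mono-≤ (ℕ.s≤s m≤n) = +-monoʳ-≤ 1# (fromℕ-mono-≤ m≤n)

  ^-product : ∀ {n} a (f : Vector Carrier n) → a ^ n * product f ≈ product (λ i → a * f i)
  ^-product {zero}  a f = *-identityˡ 1#
  ^-product {suc n} a f = begin-equality
    a * a ^ n * (head f * product (tail f))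
      ≈⟨ solve 4 (λ a p h t → a :* p :* (h :* t) := a :* h :* (p :* t)) refl a (a ^ n) (head f) (product (tail f)) ⟩
    a * head f * (a ^ n * product (tail f))
      ≈⟨ *-congˡ (^-product a (tail f)) ⟩
    product (λ i → a * f i) ∎

  product-cong : ∀ {n} {f g : Vector Carrier n} → (∀ i → f i ≈ g i) → product f ≈ product g
  product-cong {zero}  f≈g = refl
  product-cong {suc n} f≈g = *-cong (f≈g zero) (product-cong λ i → f≈g (suc i))

  -- A product over `Fin` unfolds at its first factor, while the induction on k appends the factor
  -- of largest index. Taking `f` on ℕ gives both lengths the same factors.
  product-last : ∀ n (f : ℕ → Carrier) →
                 product (λ (i : Fin (suc n)) → f (toℕ i)) ≈ product (λ (i : Fin n) → f (toℕ i)) * f n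
  product-last zero    f = *-comm (f 0) 1#
  product-last (suc n) f = trans (*-congˡ (product-last n λ i → f (suc i))) (sym (*-assoc _ _ _))

-- Elementary symmetric functions by recursion.

module ElementarySymmetric {c ℓ₁ ℓ₂} (ℝ : CompleteOrderedField c ℓ₁ ℓ₂) where
  open CompleteOrderedField ℝ hiding (zero)
  open Notions ℝ
  open OrderedFieldProperties ℝ
  open SumProperties ℝ
  open SemiringMult semiring using (×1-homo-*)
  open RingProperties ring using (-‿distribʳ-*)
  open GroupProperties +-group using (x∙y⁻¹≈ε⇒x≈y)
    renaming (∙-cancelˡ to +-cancelˡ)
  open NaturalSolver commutativeSemiring using (solve; _:=_; _:+_; _:*_; con)
  open PartialOrderReasoning poset

  -- The subsets of size k + 1 are divided by whether they contain the first index; this recursion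
  -- stands in for the sum over subsets in `S`.
  e : ∀ {n} → ℕ → Vector Carrier n → Carrier
  e         zero    x = 1#
  e {zero}  (suc k) x = 0#
  e {suc n} (suc k) x = head x * e k (tail x) + e (suc k) (tail x)

  -- eWithout k x i is the d_k,i of the introduction.
  eWithout : ∀ {n} → ℕ → Vector Carrier n → Fin n → Carrier
  eWithout k       x zero    = e k (tail x)
  eWithout zero    x (suc i) = 1#
  eWithout (suc k) x (suc i) = head x * eWithout k (tail x) i + eWithout (suc k) (tail x) i

  -- Agreement of the recursion with the sum over subsets.

  ∑ₗ : ∀ {n} → Vector Carrier n → List (Subset n) → Carrier
  ∑ₗ x ps = List.foldr _+_ 0# (List.map (monomial x) ps)

  ∑ₗ-++ : ∀ {n} (x : Vector Carrier n) ps ps′ → ∑ₗ x (ps ++ ps′) ≈ ∑ₗ x ps + ∑ₗ x ps′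
  ∑ₗ-++ x []       ps′ = sym (+-identityˡ _)
  ∑ₗ-++ x (p ∷ ps) ps′ = trans (+-congˡ (∑ₗ-++ x ps ps′)) (sym (+-assoc _ _ _))

  -- The filter of `subsetsOfSize` on an arbitrary list, so that induction on the list is possible;
  -- `S k x` is `∑ₗ x (ofSize k (allSubsets n))` by definition.
  ofSize : ∀ {n} → ℕ → List (Subset n) → List (Subset n)
  ofSize k = List.filter (λ p → ∣ p ∣ ℕ.≟ k)

  ∑ₗ-inside : ∀ {n} k (x : Vector Carrier (suc n)) ps →
              ∑ₗ x (ofSize (suc k) (List.map (inside Vec.∷_) ps)) ≈ head x * ∑ₗ (tail x) (ofSize k ps)
  ∑ₗ-inside k x [] = sym (zeroʳ (head x))
  -- Comparing the size of `inside ∷ p` with k + 1 computes to the same Boolean, so one `with`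
  -- evaluates both filters.
  ∑ₗ-inside k x (p ∷ ps) with does (∣ p ∣ ℕ.≟ k)
  ... | true  = trans (+-congˡ (∑ₗ-inside k x ps)) (sym (distribˡ _ _ _))
  ... | false = ∑ₗ-inside k x ps

  ∑ₗ-inside-0 : ∀ {n} (x : Vector Carrier (suc n)) ps →
                ∑ₗ x (ofSize 0 (List.map (inside Vec.∷_) ps)) ≈ 0#
  ∑ₗ-inside-0 x []       = refl
  ∑ₗ-inside-0 x (p ∷ ps) = ∑ₗ-inside-0 x ps

  ∑ₗ-outside : ∀ {n} k (x : Vector Carrier (suc n)) ps →
               ∑ₗ x (ofSize k (List.map (outside Vec.∷_) ps)) ≈ ∑ₗ (tail x) (ofSize k ps)
  ∑ₗ-outside k x [] = refl
  ∑ₗ-outside k x (p ∷ ps) with does (∣ p ∣ ℕ.≟ k)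
  ... | true  = +-cong (*-identityˡ _) (∑ₗ-outside k x ps)
  ... | false = ∑ₗ-outside k x ps

  S≈e : ∀ {n} k (x : Vector Carrier n) → S k x ≈ e k x
  S≈e {zero}  zero    x = +-identityʳ 1#
  S≈e {zero}  (suc k) x = refl
  S≈e {suc n} k       x = begin-equality
    S k x
      ≡⟨ ≡.cong (∑ₗ x) (filter-++ (λ p → ∣ p ∣ ℕ.≟ k) ins outs) ⟩
    ∑ₗ x (ofSize k ins ++ ofSize k outs)
      ≈⟨ ∑ₗ-++ x (ofSize k ins) (ofSize k outs) ⟩
    ∑ₗ x (ofSize k ins) + ∑ₗ x (ofSize k outs)
      ≈⟨ +-congˡ (trans (∑ₗ-outside k x (allSubsets n)) (S≈e k (tail x))) ⟩
    ∑ₗ x (ofSize k ins) + e k (tail x)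
      ≈⟨ split k ⟩
    e k x ∎
    where
    ins  = List.map (inside Vec.∷_) (allSubsets n)
    outs = List.map (outside Vec.∷_) (allSubsets n)

    split : ∀ k → ∑ₗ x (ofSize k ins) + e k (tail x) ≈ e k x
    split zero    = trans (+-congʳ (∑ₗ-inside-0 x (allSubsets n))) (+-identityˡ 1#)
    split (suc k) = +-congʳ (trans (∑ₗ-inside k x (allSubsets n)) (*-congˡ (S≈e k (tail x))))

  -- Sign, splitting at an index, monotonicity and double counting.

  e-nonNegative : ∀ {n} k {x : Vector Carrier n} → (∀ i → 0# ≤ x i) → 0# ≤ e k x
  e-nonNegative         zero    0≤x = proj₁ 0<1
  e-nonNegative {zero}  (suc k) 0≤x = ≤-refl
  e-nonNegative {suc n} (suc k) 0≤x =
    +-nonNegative (*-nonNegative (0≤x zero) (e-nonNegative k λ i → 0≤x (suc i)))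
                  (e-nonNegative (suc k) λ i → 0≤x (suc i))

  eWithout-nonNegative : ∀ {n} k {x : Vector Carrier n} → (∀ i → 0# ≤ x i) →
                         ∀ i → 0# ≤ eWithout k x i
  eWithout-nonNegative k       0≤x zero    = e-nonNegative k λ i → 0≤x (suc i)
  eWithout-nonNegative zero    0≤x (suc i) = proj₁ 0<1
  eWithout-nonNegative (suc k) 0≤x (suc i) =
    +-nonNegative (*-nonNegative (0≤x zero) (eWithout-nonNegative k (λ j → 0≤x (suc j)) i))
                  (eWithout-nonNegative (suc k) (λ j → 0≤x (suc j)) i)

  -- The clauses of `eWithout` match on the index, so this holds by computation only once `i` is
  -- split.
  eWithout-zero : ∀ {n} (x : Vector Carrier n) i → eWithout 0 x i ≈ 1#
  eWithout-zero x zero    = refl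
  eWithout-zero x (suc i) = refl

  -- A subset of size k + 1 either contains `i` or avoids it. This extends the defining recursion of
  -- `e` from the first index to all indices.
  e-split : ∀ {n} k (x : Vector Carrier n) i →
            e (suc k) x ≈ x i * eWithout k x i + eWithout (suc k) x i
  e-split k       x zero    = refl
  e-split zero    x (suc i) = begin-equality
    x₀ * 1# + e 1 (tail x)               ≈⟨ +-congˡ (e-split 0 (tail x) i) ⟩
    x₀ * 1# + (xᵢ * eWithout 0 (tail x) i + r)  ≈⟨ +-congˡ (+-congʳ (*-congˡ (eWithout-zero (tail x) i))) ⟩
    x₀ * 1# + (xᵢ * 1# + r)              ≈⟨ solve 3 (λ a b r → a :* con 1 :+ (b :* con 1 :+ r)
                                               := b :* con 1 :+ (a :* con 1 :+ r)) refl x₀ xᵢ r ⟩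
    xᵢ * 1# + (x₀ * 1# + r)              ≈⟨ +-congˡ (+-congʳ (*-congˡ (eWithout-zero (tail x) i))) ⟨
    xᵢ * 1# + (x₀ * eWithout 0 (tail x) i + r)  ∎
    where
    x₀ = head x
    xᵢ = tail x i
    r = eWithout 1 (tail x) i
  e-split (suc k) x (suc i) = begin-equality
    x₀ * e (suc k) (tail x) + e (suc (suc k)) (tail x)
      ≈⟨ +-cong (*-congˡ (e-split k (tail x) i)) (e-split (suc k) (tail x) i) ⟩
    x₀ * (xᵢ * u + v) + (xᵢ * v + w)
      ≈⟨ solve 5 (λ a b u v w → a :* (b :* u :+ v) :+ (b :* v :+ w)
                    := b :* (a :* u :+ v) :+ (a :* v :+ w)) refl x₀ xᵢ u v w ⟩
    xᵢ * (x₀ * u + v) + (x₀ * v + w) ∎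
    where
    x₀ = head x
    xᵢ = tail x i
    u = eWithout k (tail x) i
    v = eWithout (suc k) (tail x) i
    w = eWithout (suc (suc k)) (tail x) i

  -- Let `u` and `v` be the functions of degrees k and k + 1 of the entries other than both `x i`
  -- and `x j`. Removing only `x j` leaves `x i * u + v`, removing only `x i` leaves `x j * u + v`.
  -- The induction strips common leading entries until one of the indices is `zero`.
  eWithout-antitone : ∀ {n} k {x : Vector Carrier n} → (∀ i → 0# ≤ x i) →
                      ∀ i j → x i ≤ x j → eWithout k x j ≤ eWithout k x i
  eWithout-antitone zero    {x} 0≤x i j xᵢ≤xⱼ =
    ≤-reflexive (trans (eWithout-zero x j) (sym (eWithout-zero x i)))
  eWithout-antitone (suc k) {x} 0≤x zero zero xᵢ≤xⱼ = ≤-refl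
  eWithout-antitone (suc k) {x} 0≤x zero (suc j) x₀≤xⱼ = begin
    head x * u + v      ≤⟨ +-mono-≤ (*-monoˡ-≤ (eWithout-nonNegative k (λ i → 0≤x (suc i)) j) x₀≤xⱼ) ≤-refl ⟩
    tail x j * u + v    ≈⟨ e-split k (tail x) j ⟨
    e (suc k) (tail x)  ∎
    where
    u = eWithout k (tail x) j
    v = eWithout (suc k) (tail x) j
  eWithout-antitone (suc k) {x} 0≤x (suc i) zero xᵢ≤x₀ = begin
    e (suc k) (tail x)  ≈⟨ e-split k (tail x) i ⟩
    tail x i * u + v    ≤⟨ +-mono-≤ (*-monoˡ-≤ (eWithout-nonNegative k (λ i → 0≤x (suc i)) i) xᵢ≤x₀) ≤-refl ⟩
    head x * u + v      ∎
    where
    u = eWithout k (tail x) i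
    v = eWithout (suc k) (tail x) i
  eWithout-antitone (suc k) {x} 0≤x (suc i) (suc j) xᵢ≤xⱼ =
    +-mono-≤ (*-monoʳ-≤ (0≤x zero) (eWithout-antitone k (λ i → 0≤x (suc i)) i j xᵢ≤xⱼ))
             (eWithout-antitone (suc k) (λ i → 0≤x (suc i)) i j xᵢ≤xⱼ)

  -- Double counting: the monomial of a subset of size k + 1 arises once for each of its elements.
  ∑x*eWithout : ∀ {n} k (x : Vector Carrier n) →
                sum (λ i → x i * eWithout k x i) ≈ fromℕ (suc k) * e (suc k) x
  ∑x*eWithout {zero}  k       x = sym (zeroʳ _)
  ∑x*eWithout {suc n} zero    x = begin-equality
    head x * 1# + sum (λ i → tail x i * 1#)
      ≈⟨ +-congˡ (sum-cong-≋ λ i → *-congˡ (eWithout-zero (tail x) i)) ⟨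
    head x * 1# + sum (λ i → tail x i * eWithout 0 (tail x) i)
      ≈⟨ +-congˡ (∑x*eWithout 0 (tail x)) ⟩
    head x * 1# + (1# + 0#) * e 1 (tail x)
      ≈⟨ solve 2 (λ a b → a :* con 1 :+ (con 1 :+ con 0) :* b
                    := (con 1 :+ con 0) :* (a :* con 1 :+ b)) refl (head x) (e 1 (tail x)) ⟩
    (1# + 0#) * (head x * 1# + e 1 (tail x)) ∎
  ∑x*eWithout {suc n} (suc k) x = begin-equality
    x₀ * E + sum (λ i → tail x i * (x₀ * u i + v i))
      ≈⟨ +-congˡ (sum-cong-≋ λ i → solve 4 (λ a b u v → b :* (a :* u :+ v) := a :* (b :* u) :+ b :* v)
                                     refl x₀ (tail x i) (u i) (v i)) ⟩
    x₀ * E + sum (λ i → x₀ * (tail x i * u i) + tail x i * v i)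
      ≈⟨ +-congˡ (∑-distrib-+ (λ i → x₀ * (tail x i * u i)) λ i → tail x i * v i) ⟩
    x₀ * E + (sum (λ i → x₀ * (tail x i * u i)) + sum (λ i → tail x i * v i))
      ≈⟨ +-congˡ (+-cong (*-distribˡ-sum x₀ λ i → tail x i * u i) (sym (∑x*eWithout (suc k) (tail x)))) ⟨
    x₀ * E + (x₀ * sum (λ i → tail x i * u i) + (1# + N) * F)
      ≈⟨ +-congˡ (+-congʳ (*-congˡ (∑x*eWithout k (tail x)))) ⟩
    -- The monomials containing `x₀` are counted once by the index `zero` and `N` times by the other
    -- indices; `1# + N` is `fromℕ (suc (suc k))` by computation.
    x₀ * E + (x₀ * (N * E) + (1# + N) * F)
      ≈⟨ solve 4 (λ a N E F → a :* E :+ (a :* (N :* E) :+ (con 1 :+ N) :* F)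
                    := (con 1 :+ N) :* (a :* E :+ F)) refl x₀ N E F ⟩
    (1# + N) * (x₀ * E + F) ∎
    where
    x₀ = head x
    N = fromℕ (suc k)
    E = e (suc k) (tail x)
    F = e (suc (suc k)) (tail x)
    u = eWithout k (tail x)
    v = eWithout (suc k) (tail x)

  -- Identities and bounds on the simplex.

  module _ {m} {x : Vector Carrier (suc m)} (x∈Δ : Δ m x) where

    0≤x : ∀ i → 0# ≤ x i
    0≤x = proj₁ x∈Δ

    ∑x≈1 : sum x ≈ 1#
    ∑x≈1 = proj₂ x∈Δ

    -- The sum of x_i² d_k,i from the introduction.
    moment : ℕ → Carrier
    moment k = sum λ i → x i * (x i * eWithout k x i)

    q≈ : q x ≈ sum λ i → x i * x i
    q≈ = sum-cong-≋ λ i → *-congˡ {x i} (*-identityʳ (x i))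

    e₁≈1 : e 1 x ≈ 1#
    e₁≈1 = begin-equality
      e 1 x                             ≈⟨ solve 1 (λ a → a := (con 1 :+ con 0) :* a) refl (e 1 x) ⟩
      -- The factor `1# + 0#` is `fromℕ 1` unfolded.
      (1# + 0#) * e 1 x                 ≈⟨ ∑x*eWithout 0 x ⟨
      sum (λ i → x i * eWithout 0 x i)  ≈⟨ sum-cong-≋ (λ i → trans (*-congˡ (eWithout-zero x i)) (*-identityʳ (x i))) ⟩
      sum x                             ≈⟨ ∑x≈1 ⟩
      1#                                ∎

    moment-zero : moment 0 ≈ q x
    moment-zero = sum-cong-≋ λ i → *-congˡ {x i} (*-congˡ {x i} (eWithout-zero x i))

    -- The identity `e-split` is weighted by `x i` and summed over `i`; the weights have total 1.
    moment-recurrence : ∀ k → moment k + fromℕ (suc (suc k)) * e (suc (suc k)) x ≈ e (suc k) x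
    moment-recurrence k = begin-equality
      moment k + fromℕ (suc (suc k)) * e (suc (suc k)) x
        ≈⟨ +-congˡ (∑x*eWithout (suc k) x) ⟨
      moment k + sum (λ i → x i * eWithout (suc k) x i)
        ≈⟨ ∑-distrib-+ (λ i → x i * (x i * eWithout k x i)) (λ i → x i * eWithout (suc k) x i) ⟨
      sum (λ i → x i * (x i * eWithout k x i) + x i * eWithout (suc k) x i)
        ≈⟨ sum-cong-≋ (λ i → trans (sym (distribˡ _ _ _))
             (trans (*-congˡ (sym (e-split k x i))) (*-comm (x i) _))) ⟩
      sum (λ i → e (suc k) x * x i)
        ≈⟨ *-distribˡ-sum (e (suc k) x) x ⟨
      e (suc k) x * sum x
        ≈⟨ trans (*-congˡ ∑x≈1) (*-identityʳ _) ⟩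
      e (suc k) x ∎

    moment-bound : ∀ k → moment k ≤ q x * (fromℕ (suc k) * e (suc k) x)
    moment-bound k = begin
      moment k
        ≈⟨ trans (*-congʳ ∑x≈1) (*-identityˡ _) ⟨
      sum x * moment k
        -- Here `x` serves both as the weights and as the sequence against which `eWithout k x` is
        -- antitone.
        ≤⟨ chebyshev x x (eWithout k x) 0≤x (eWithout-antitone k 0≤x) ⟩
      sum (λ i → x i * x i) * sum (λ i → x i * eWithout k x i)
        ≈⟨ *-cong (sym q≈) (∑x*eWithout k x) ⟩
      q x * (fromℕ (suc k) * e (suc k) x) ∎

    2e₂+q≈1 : fromℕ 2 * e 2 x + q x ≈ 1#
    2e₂+q≈1 = begin-equality
      fromℕ 2 * e 2 x + q x      ≈⟨ +-comm _ _ ⟩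
      q x + fromℕ 2 * e 2 x      ≈⟨ +-congʳ moment-zero ⟨
      moment 0 + fromℕ 2 * e 2 x ≈⟨ moment-recurrence 0 ⟩
      e 1 x                      ≈⟨ e₁≈1 ⟩
      1#                         ∎

    p₃ : Carrier
    p₃ = sum λ i → x i * (x i * x i)

    -- Since `e 1 x` is 1, the sum of the entries other than `x i` is 1 - `x i`.
    moment₁+p₃≈q : moment 1 + p₃ ≈ q x
    moment₁+p₃≈q = begin-equality
      moment 1 + p₃
        ≈⟨ ∑-distrib-+ (λ i → x i * (x i * eWithout 1 x i)) (λ i → x i * (x i * x i)) ⟨
      sum (λ i → x i * (x i * eWithout 1 x i) + x i * (x i * x i))
        ≈⟨ sum-cong-≋ (λ i → begin-equality
             x i * (x i * eWithout 1 x i) + x i * (x i * x i)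
               ≈⟨ solve 2 (λ a d → a :* (a :* d) :+ a :* (a :* a) := a :* (a :* (a :* con 1 :+ d)))
                    refl (x i) (eWithout 1 x i) ⟩
             x i * (x i * (x i * 1# + eWithout 1 x i))
               ≈⟨ *-congˡ (*-congˡ (+-congʳ (*-congˡ (eWithout-zero x i)))) ⟨
             x i * (x i * (x i * eWithout 0 x i + eWithout 1 x i))
               ≈⟨ *-congˡ (*-congˡ (trans (sym (e-split 0 x i)) e₁≈1)) ⟩
             x i ^ 2 ∎) ⟩
      q x ∎

    -- The variance of a random variable that takes the value `x i` with probability `x i`; its mean
    -- is `q x`.
    variance : Carrier
    variance = sum λ i → x i * ((x i - q x) * (x i - q x))

    -- The second moment is the squared mean plus the variance. Adding `Q * Q` to both sides keeps
    -- the expansion of the square free of negative terms.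
    p₃≈q²+variance : p₃ ≈ q x * q x + variance
    p₃≈q²+variance = +-cancelˡ (Q * Q) p₃ (Q * Q + variance) (begin-equality
      Q * Q + p₃
        ≈⟨ +-congʳ (trans (*-congˡ ∑x≈1) (*-identityʳ (Q * Q))) ⟨
      Q * Q * sum x + p₃
        ≈⟨ +-congʳ (*-distribˡ-sum (Q * Q) x) ⟩
      sum (λ i → Q * Q * x i) + p₃
        ≈⟨ ∑-distrib-+ (λ i → Q * Q * x i) (λ i → x i * (x i * x i)) ⟨
      sum (λ i → Q * Q * x i + x i * (x i * x i))
        ≈⟨ sum-cong-≋ termwise ⟩
      sum (λ i → (Q + Q) * (x i * x i) + x i * ((x i - Q) * (x i - Q)))
        ≈⟨ ∑-distrib-+ (λ i → (Q + Q) * (x i * x i)) (λ i → x i * ((x i - Q) * (x i - Q))) ⟩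
      sum (λ i → (Q + Q) * (x i * x i)) + variance
        ≈⟨ +-congʳ (trans (sym (*-distribˡ-sum (Q + Q) λ i → x i * x i)) (*-congˡ (sym q≈))) ⟩
      (Q + Q) * Q + variance
        ≈⟨ solve 2 (λ Q v → (Q :+ Q) :* Q :+ v := Q :* Q :+ (Q :* Q :+ v)) refl Q variance ⟩
      Q * Q + (Q * Q + variance) ∎)
      where
      Q = q x

      termwise : ∀ i → Q * Q * x i + x i * (x i * x i) ≈
                       (Q + Q) * (x i * x i) + x i * ((x i - Q) * (x i - Q))
      termwise i = begin-equality
        Q * Q * x i + x i * (x i * x i)
          -- Only two of the three factors become `Q + u`; the third remains as the weight.
          ≈⟨ +-congˡ (*-congˡ (*-cong xᵢ≈Q+u xᵢ≈Q+u)) ⟩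
        Q * Q * x i + x i * ((Q + u) * (Q + u))
          ≈⟨ solve 3 (λ Q a u → Q :* Q :* a :+ a :* ((Q :+ u) :* (Q :+ u))
                        := (Q :+ Q) :* (a :* (Q :+ u)) :+ a :* (u :* u)) refl Q (x i) u ⟩
        (Q + Q) * (x i * (Q + u)) + x i * (u * u)
          ≈⟨ +-congʳ (*-congˡ (*-congˡ xᵢ≈Q+u)) ⟨
        (Q + Q) * (x i * x i) + x i * (u * u) ∎
        where
        u = x i - Q
        xᵢ≈Q+u = sym (x+[y-x]≈y Q (x i))

    -- `q x` is the average of the entries with the entries themselves as weights.
    q≤∣x∣max : q x ≤ ∣ x ∣max
    q≤∣x∣max = begin
      q x                           ≈⟨ q≈ ⟩
      sum (λ i → x i * x i)         ≤⟨ sum-mono-≤ (λ i → *-monoˡ-≤ (0≤x i) (x≤∣x∣max x i)) ⟩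
      sum (λ i → ∣ x ∣max * x i)    ≈⟨ *-distribˡ-sum ∣ x ∣max x ⟨
      ∣ x ∣max * sum x              ≈⟨ trans (*-congˡ ∑x≈1) (*-identityʳ _) ⟩
      ∣ x ∣max                      ∎

    e-suc-≤ : ∀ k → e (suc k) x ≤
                  q x * (fromℕ (suc k) * e (suc k) x) + fromℕ (suc (suc k)) * e (suc (suc k)) x
    e-suc-≤ k = ≤-trans (≤-reflexive (sym (moment-recurrence k))) (+-mono-≤ (moment-bound k) ≤-refl)

    -- If the variance is not positive, each of its nonnegative terms vanishes, and then every
    -- nonzero entry equals the mean `q x`.
    variance-positive : ¬ NonzeroEntriesEqual x → 0# < variance
    variance-positive ¬equal = ≰⇒> λ variance≤0 → ¬equal λ i j xᵢ≉0 xⱼ≉0 →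
      trans (≈q variance≤0 i xᵢ≉0) (sym (≈q variance≤0 j xⱼ≉0))
      where
      ≈q : variance ≤ 0# → ∀ i → x i ≉ 0# → x i ≈ q x
      ≈q variance≤0 i xᵢ≉0 with x i ≟ q x
      ... | yes eq = eq
      ... | no xᵢ≉q = contradiction
        (sum-nonPositive⇒≈0 (λ j → *-nonNegative (0≤x j) (0≤x*x (x j - q x))) variance≤0 i)
        (>⇒≉ (*-positive (0≤x i , λ eq → xᵢ≉0 (sym eq))
                         (x≉0⇒0<x*x λ eq → xᵢ≉q (x∙y⁻¹≈ε⇒x≈y _ _ eq))))

    -- Otherwise all squares, hence all entries, would vanish, although their sum is 1. This
    -- justifies dividing by `q x`.
    q-positive : 0# < q x
    q-positive = ≰⇒> λ q≤0 → <⇒≱ 0<1 (begin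
      1#                        ≈⟨ ∑x≈1 ⟨
      sum x                     ≈⟨ sum-cong-≋ (≈0 q≤0) ⟩
      sum (replicate (suc m) 0#)  ≈⟨ sum-replicate-zero (suc m) ⟩
      0#                        ∎)
      where
      ≈0 : q x ≤ 0# → ∀ i → x i ≈ 0#
      ≈0 q≤0 i with x i ≟ 0#
      ... | yes eq = eq
      ... | no xᵢ≉0 = contradiction
        (sum-nonPositive⇒≈0 (λ j → 0≤x*x (x j)) (≤-trans (≤-reflexive (sym q≈)) q≤0) i)
        (x≉0⇒x*x≉0 xᵢ≉0)

    e-suc-< : ¬ NonzeroEntriesEqual x → e 2 x < q x * (fromℕ 2 * e 2 x) + fromℕ 3 * e 3 x
    e-suc-< ¬equal = begin-strict
      e 2 x                                       ≈⟨ moment-recurrence 1 ⟨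
      moment 1 + fromℕ 3 * e 3 x                  ≈⟨ +-comm _ _ ⟩
      fromℕ 3 * e 3 x + moment 1                  <⟨ +-monoʳ-< _ moment₁< ⟩
      fromℕ 3 * e 3 x + q x * (fromℕ 2 * e 2 x)   ≈⟨ +-comm _ _ ⟩
      q x * (fromℕ 2 * e 2 x) + fromℕ 3 * e 3 x   ∎
      where
      Q = q x

      moment₁< : moment 1 < Q * (fromℕ 2 * e 2 x)
      -- With `Q * Q` added, the gap between the two sides is exactly the variance.
      moment₁< = +-cancelˡ-< (Q * Q) (begin-strict
        Q * Q + moment 1               ≈⟨ +-comm _ _ ⟩
        moment 1 + Q * Q               ≈⟨ +-congˡ (+-identityʳ (Q * Q)) ⟨
        moment 1 + (Q * Q + 0#)        <⟨ +-monoʳ-< _ (+-monoʳ-< (Q * Q) (variance-positive ¬equal)) ⟩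
        moment 1 + (Q * Q + variance)  ≈⟨ +-congˡ p₃≈q²+variance ⟨
        moment 1 + p₃                  ≈⟨ moment₁+p₃≈q ⟩
        Q                              ≈⟨ trans (*-congˡ 2e₂+q≈1) (*-identityʳ Q) ⟨
        Q * (fromℕ 2 * e 2 x + Q)      ≈⟨ solve 2 (λ Q t → Q :* (t :+ Q) := Q :* Q :+ Q :* t) refl Q (fromℕ 2 * e 2 x) ⟩
        Q * Q + Q * (fromℕ 2 * e 2 x)  ∎)

    -- Comparison with the scaled falling factorial.

    factor : ℕ → Carrier
    factor j = 1# - fromℕ j * q x

    -- This is q^k times the falling factorial of 1/q of length k, with each power of q absorbed
    -- into a factor: q (1/q - j) = 1 - j q.
    falling : ℕ → Carrier
    falling k = product λ (i : Fin k) → factor (toℕ i)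

    q^k*binom : ∀ k → q x ^ k * binom (1# / q x) k ≈ falling k * fromℕ (k !) ⁻¹
    q^k*binom k = begin-equality
      q x ^ k * (product binomFactor * fromℕ (k !) ⁻¹)  ≈⟨ *-assoc _ _ _ ⟨
      q x ^ k * product binomFactor * fromℕ (k !) ⁻¹
        ≈⟨ *-congʳ (trans (^-product (q x) binomFactor) (product-cong termwise)) ⟩
      falling k * fromℕ (k !) ⁻¹              ∎
      where
      binomFactor : Fin k → Carrier
      binomFactor i = 1# / q x - fromℕ (toℕ i)

      termwise : ∀ i → q x * binomFactor i ≈ factor (toℕ i)
      termwise i = begin-equality
        q x * (1# * q x ⁻¹ - j)         ≈⟨ distribˡ _ _ _ ⟩
        q x * (1# * q x ⁻¹) + q x * - j
          ≈⟨ +-cong (trans (*-congˡ (*-identityˡ _)) (⁻¹-inverseʳ (>⇒≉ q-positive)))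
                    (trans (sym (-‿distribʳ-* _ _)) (-‿cong (*-comm _ _))) ⟩
        1# - j * q x                    ∎
        where j = fromℕ (toℕ i)

    scaled : ℕ → Carrier
    scaled k = fromℕ (k !) * e k x

    scaled-suc : ∀ k → fromℕ (k !) * (fromℕ (suc k) * e (suc k) x) ≈ scaled (suc k)
    scaled-suc k = begin-equality
      F * (N * E)                    ≈⟨ solve 3 (λ F N E → F :* (N :* E) := N :* F :* E) refl F N E ⟩
      N * F * E                      ≈⟨ *-congʳ (×1-homo-* (suc k) (k !)) ⟨
      fromℕ (suc k ℕ.* k !) * E      ∎
      where
      F = fromℕ (k !)
      N = fromℕ (suc k)
      E = e (suc k) x

    -- Splits off the term k q e_k, which also occurs in `e-suc-≤` and `e-suc-<`; cancelling it
    -- leaves a bound with `factor k`.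
    kqe+e*factor : ∀ k → q x * (fromℕ k * e k x) + e k x * factor k ≈ e k x
    kqe+e*factor k = begin-equality
      Q * (N * E) + E * factor k  ≈⟨ solve 4 (λ Q N E r → Q :* (N :* E) :+ E :* r
                                         := E :* (N :* Q :+ r)) refl Q N E (factor k) ⟩
      E * (N * Q + factor k)      ≈⟨ *-congˡ (x+[y-x]≈y (N * Q) 1#) ⟩
      E * 1#                      ≈⟨ *-identityʳ E ⟩
      E                           ∎
      where
      N = fromℕ k
      E = e k x
      Q = q x

    scaled-step-≤ : ∀ k → scaled (suc k) * factor (suc k) ≤ scaled (suc (suc k))
    scaled-step-≤ k = begin
      scaled (suc k) * factor (suc k)  ≈⟨ *-assoc _ _ _ ⟩
      fromℕ (suc k !) * (e (suc k) x * factor (suc k))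
        ≤⟨ *-monoʳ-≤ (fromℕ-nonNegative (suc k !))
             (+-cancelˡ-≤ _ (≤-trans (≤-reflexive (kqe+e*factor (suc k))) (e-suc-≤ k))) ⟩
      fromℕ (suc k !) * (fromℕ (suc (suc k)) * e (suc (suc k)) x)
        ≈⟨ scaled-suc (suc k) ⟩
      scaled (suc (suc k))             ∎

    -- Both sides are 1 - q. The comparison starts with equality here, so strictness has to come
    -- from the step to degree 3.
    scaled-2 : scaled 2 ≈ falling 2
    scaled-2 = +-cancelˡ (q x) (scaled 2) (falling 2) (begin-equality
      q x + scaled 2                                   ≈⟨ +-comm _ _ ⟩
      scaled 2 + q x                                   ≈⟨ 2e₂+q≈1 ⟩
      1#                                               ≈⟨ x+[y-x]≈y (fromℕ 1 * q x) 1# ⟨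
      fromℕ 1 * q x + factor 1
        ≈⟨ solve 2 (λ Q r → (con 1 :+ con 0) :* Q :+ r := Q :+ con 1 :* (r :* con 1)) refl (q x) (factor 1) ⟩
      q x + 1# * (factor 1 * 1#)                       ≈⟨ +-congˡ (*-congʳ factor-0) ⟨
      q x + falling 2                                  ∎)
      where
      factor-0 : factor 0 ≈ 1#
      factor-0 = trans (solve 2 (λ Q r → r := con 0 :* Q :+ r) refl (q x) (factor 0))
                       (x+[y-x]≈y (fromℕ 0 * q x) 1#)

    scaled-step-<-3 : ¬ NonzeroEntriesEqual x → scaled 2 * factor 2 < scaled 3
    scaled-step-<-3 ¬equal = begin-strict
      scaled 2 * factor 2                ≈⟨ *-assoc _ _ _ ⟩
      fromℕ (2 !) * (e 2 x * factor 2)   <⟨ *-monoʳ-< (fromℕ-positive (2 !)) (+-cancelˡ-< _ e*factor<) ⟩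
      fromℕ (2 !) * (fromℕ 3 * e 3 x)    ≈⟨ scaled-suc 2 ⟩
      scaled 3                           ∎
      where
      e*factor< : q x * (fromℕ 2 * e 2 x) + e 2 x * factor 2 <
                  q x * (fromℕ 2 * e 2 x) + fromℕ 3 * e 3 x
      e*factor< = begin-strict
        q x * (fromℕ 2 * e 2 x) + e 2 x * factor 2  ≈⟨ kqe+e*factor 2 ⟩
        e 2 x                                       <⟨ e-suc-< ¬equal ⟩
        q x * (fromℕ 2 * e 2 x) + fromℕ 3 * e 3 x   ∎

    -- Induction from degree 3. The assumption says that the last factor of `falling (3 ℕ.+ j)` is
    -- positive; as q is positive, it passes to smaller `j`.
    falling<scaled : ¬ NonzeroEntriesEqual x → ∀ j → fromℕ (2 ℕ.+ j) * q x < 1# →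
                     falling (3 ℕ.+ j) < scaled (3 ℕ.+ j)
    falling<scaled ¬equal zero    _ = begin-strict
      falling 3             ≈⟨ product-last 2 factor ⟩
      falling 2 * factor 2  ≈⟨ *-congʳ scaled-2 ⟨
      scaled 2 * factor 2   <⟨ scaled-step-<-3 ¬equal ⟩
      scaled 3              ∎
    falling<scaled ¬equal (suc j) jq<1 = begin-strict
      falling (4 ℕ.+ j)                      ≈⟨ product-last (3 ℕ.+ j) factor ⟩
      falling (3 ℕ.+ j) * factor (3 ℕ.+ j)  <⟨ *-monoˡ-< (x<y⇒0<y-x jq<1) (falling<scaled ¬equal j (begin-strict
        fromℕ (2 ℕ.+ j) * q x  ≤⟨ *-monoˡ-≤ (proj₁ q-positive) (fromℕ-mono-≤ (ℕ.n≤1+n (2 ℕ.+ j))) ⟩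
        fromℕ (3 ℕ.+ j) * q x  <⟨ jq<1 ⟩
        1#                     ∎)) ⟩
      scaled (3 ℕ.+ j) * factor (3 ℕ.+ j)   ≤⟨ scaled-step-≤ (2 ℕ.+ j) ⟩
      scaled (4 ℕ.+ j)                       ∎

    -- Here `suc k` is the degree in the theorem, so `M` is that degree minus one. Multiplying the
    -- bound on the maximum by `M` and using `q≤∣x∣max` gives the claim.
    kq<1 : ∀ k .{{_ : ℕ.NonZero k}} → ∣ x ∣max < 1# / (fromℕ (suc k) - 1#) → fromℕ k * q x < 1#
    kq<1 k max< = begin-strict
      fromℕ k * q x                         ≈⟨ *-congʳ k≈ ⟩
      M * q x                               ≤⟨ *-monoʳ-≤ (proj₁ 0<M) q≤∣x∣max ⟩
      M * ∣ x ∣max                          <⟨ *-monoʳ-< 0<M max< ⟩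
      M * (1# * M ⁻¹)                       ≈⟨ *-congˡ (*-identityˡ _) ⟩
      M * M ⁻¹                              ≈⟨ ⁻¹-inverseʳ (>⇒≉ 0<M) ⟩
      1#                                    ∎
      where
      M = fromℕ (suc k) - 1#

      k≈ : fromℕ k ≈ M
      k≈ = +-cancelˡ 1# (fromℕ k) M (sym (x+[y-x]≈y 1# (fromℕ (suc k))))

      0<M : 0# < M
      0<M = begin-strict
        0#       <⟨ fromℕ-positive k ⟩
        fromℕ k  ≈⟨ k≈ ⟩
        M        ∎

    q^k*binom<S : ¬ NonzeroEntriesEqual x → ∀ j → fromℕ (2 ℕ.+ j) * q x < 1# →
                  q x ^ (3 ℕ.+ j) * binom (1# / q x) (3 ℕ.+ j) < S (3 ℕ.+ j) x
    q^k*binom<S ¬equal j jq<1 = begin-strict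
      q x ^ k * binom (1# / q x) k  ≈⟨ q^k*binom k ⟩
      -- Dividing by k! preserves strictness because `F ⁻¹` is positive.
      falling k * F ⁻¹              <⟨ *-monoˡ-< (⁻¹-positive 0<F) (falling<scaled ¬equal j jq<1) ⟩
      F * e k x * F ⁻¹              ≈⟨ solve 3 (λ F E I → F :* E :* I := F :* I :* E) refl F (e k x) (F ⁻¹) ⟩
      F * F ⁻¹ * e k x              ≈⟨ *-congʳ (⁻¹-inverseʳ (>⇒≉ 0<F)) ⟩
      1# * e k x                    ≈⟨ *-identityˡ _ ⟩
      e k x                         ≈⟨ S≈e k x ⟨
      S k x                         ∎
      where
      k = 3 ℕ.+ j
      F = fromℕ (k !)
      0<F : 0# < F
      0<F = fromℕ-positive (k !) {{k ℕ.!≢0}}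

theorem3 : ∀ {c ℓ₁ ℓ₂} (ℝ : CompleteOrderedField c ℓ₁ ℓ₂) →
    let open CompleteOrderedField ℝ
        open Notions ℝ
    in (k m : ℕ) → 3 ℕ.≤ k →
       (x : Vector Carrier (suc m)) → Δ m x →
       ∣ x ∣max < 1# / (fromℕ k - 1#) →
       ¬ NonzeroEntriesEqual x →
       q x ^ k * binom (1# / q x) k < S k x
theorem3 ℝ (suc (suc (suc j))) m (ℕ.s≤s (ℕ.s≤s (ℕ.s≤s ℕ.z≤n))) x x∈Δ max< ¬equal =
  -- The degree is 3 + `j`, so its predecessor 2 + `j` is the argument of `kq<1`.
  q^k*binom<S x∈Δ ¬equal j (kq<1 x∈Δ (2 ℕ.+ j) max<)
  where open ElementarySymmetric ℝ
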